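{- $t(K(7,3))=\frac{4}{3}$. Moreover, if $S$ is a vertex cut of $K(7,3)$ such that $\frac{|S|}{c(K(7,3)\setminus S)} = \frac{4}{3}$, then $S$ is the complement of a maximum independent set of $K(7,3)$.
   Context: The Kneser graph $K(n,k)$ has as vertices the $k$-element subsets of $[n]=\{1,\dots,n\}$, two vertices adjacent iff the subsets are disjoint. A vertex cut is a set $S$ of vertices whose removal disconnects the graph; $c(G\setminus S)$ is the number of connected components after deleting $S$; the toughness is $t(G)=\min_S |S|/c(G\setminus S)$ over all vertex cuts $S$. -}

module Defs where

open import Data.Nat using (ℕ; zero; suc; _+_; _*_; _≤_; _≡ᵇ_)
open import Data.Bool using (Bool; true; false; not; _∧_; if_then_else_)
open import Data.Fin using (Fin)
open import Data.Fin.Subset using (Subset; _∩_; ∣_∣; Empty)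
open import Data.List using (List; []; _∷_; _++_; map; filter; length; foldr)
open import Data.Vec using (_∷_; [])
open import Data.Product using (Σ; _×_; ∃)
open import Function.Bundles using (_⇔_)
open import Relation.Binary.PropositionalEquality using (_≡_)
open import Relation.Nullary using (¬_)

IsVertex : (n k : ℕ) → Subset n → Set
IsVertex n k s = ∣ s ∣ ≡ k

Adjacent : {n : ℕ} → Subset n → Subset n → Set
Adjacent u v = Empty (u ∩ v)

-- A set of vertices of K(n,k) is a Boolean predicate on subsets of [n];
-- only its values on k-subsets are relevant.
VSet : ℕ → Set
VSet n = Subset n → Bool

allSubsets : (n : ℕ) → List (Subset n)
allSubsets zero = [] ∷ []
allSubsets (suc n) = map (true ∷_) (allSubsets n) ++ map (false ∷_) (allSubsets n)

size : (n k : ℕ) → VSet n → ℕ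
size n k S = foldr (λ s acc → (if (∣ s ∣ ≡ᵇ k) ∧ S s then 1 else 0) + acc) 0 (allSubsets n)

Alive : (n k : ℕ) → VSet n → Subset n → Set
Alive n k S v = IsVertex n k v × S v ≡ false

-- Reachability inside the induced subgraph K(n,k) ∖ S
-- (used only between vertices that are Alive).
data Reach (n k : ℕ) (S : VSet n) : Subset n → Subset n → Set where
  here : ∀ {u} → Reach n k S u u
  step : ∀ {u v w} → Adjacent u v → Alive n k S v → Reach n k S v w → Reach n k S u w

ComponentCount : (n k : ℕ) → VSet n → ℕ → Set
ComponentCount n k S m =
  Σ (Subset n → Fin m) λ f →
    ((i : Fin m) → Σ (Subset n) λ u → Alive n k S u × f u ≡ i)
    × ((u v : Subset n) → Alive n k S u → Alive n k S v →
         (f u ≡ f v) ⇔ Reach n k S u v)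

VertexCut : (n k : ℕ) → VSet n → ℕ → Set
VertexCut n k S m = ComponentCount n k S m × 2 ≤ m

-- t(K(n,k)) = p / q  (q > 0), i.e. min over vertex cuts S of |S| / c(K(n,k) ∖ S)
-- equals p/q: every cut has |S|/c ≥ p/q and some cut attains p/q.
ToughnessIs : (n k p q : ℕ) → Set
ToughnessIs n k p q =
  ((S : VSet n) (m : ℕ) → VertexCut n k S m → p * m ≤ q * size n k S)
  × (Σ (VSet n) λ S → Σ ℕ λ m → VertexCut n k S m × q * size n k S ≡ p * m)

Independent : (n k : ℕ) → VSet n → Set
Independent n k I =
  (u v : Subset n) → IsVertex n k u → IsVertex n k v → I u ≡ true → I v ≡ true → ¬ Adjacent u v

MaximumIndependent : (n k : ℕ) → VSet n → Set
MaximumIndependent n k I =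
  Independent n k I × ((J : VSet n) → Independent n k J → size n k J ≤ size n k I)

IsComplementOf : (n k : ℕ) → VSet n → VSet n → Set
IsComplementOf n k S I = (v : Subset n) → IsVertex n k v → S v ≡ not (I v)

{-# OPTIONS --safe #-}
module Submission where

open import Defs
open import Data.Bool using (Bool; true; false; not; _∧_; if_then_else_)
import Data.Bool.Properties as Bool
open import Data.Fin as Fin using (Fin)
import Data.Fin.Properties as Fin
open import Data.Fin.Subset using (Subset; ∣_∣)
open import Data.Fin.Subset.Properties using (∩-idem; Empty-unique; ∣⊥∣≡0)
open import Data.List using (List; []; _∷_; _++_; map; allFin; length; lookup)
open import Data.List.Membership.Propositional using (_∈_)
open import Data.List.Membership.Propositional.Properties
  using (∈-allFin; ∈-lookup; ∈-map⁺; ∈-map⁻; ∈-++⁺ˡ; ∈-++⁺ʳ; ∈-++⁻)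
open import Data.List.Properties using (length-tabulate)
open import Data.List.Relation.Unary.All as All using (_∷_; all?)
open import Data.List.Relation.Unary.Any using (here; there; index)
open import Data.List.Relation.Unary.Any.Properties using (lookup-index)
open import Data.List.Relation.Unary.Unique.Propositional using (Unique; _∷_)
open import Data.List.Relation.Unary.Unique.Propositional.Properties using (allFin⁺)
open import Data.Nat
open import Data.Nat.DivMod using (/-monoˡ-≤; m*n/n≡m)
open import Data.Nat.ListAction using (sum)
open import Data.Nat.Properties
open import Data.Nat.Tactic.RingSolver using (solve-∀)
open import Data.Product using (Σ; _×_; _,_; proj₁; proj₂)
open import Data.Sum using (_⊎_; inj₁; inj₂)
open import Data.Vec using ([]; _∷_; here; there)
open import Data.Vec.Properties using (≡-dec)
open import Data.List.Membership.DecPropositional (≡-dec {n = 7} Bool._≟_) using (_∈?_)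
open import Function using (_∘_; id)
open import Function.Bundles using (Equivalence; mk⇔)
import Relation.Binary as R
open import Relation.Binary.PropositionalEquality
open import Relation.Nullary using (yes; no; contradiction)
open import Relation.Nullary.Decidable using (True; toWitness; _×-dec_; _→-dec_; does; dec-true)
import Relation.Unary as U

-- Let A be the adjacency matrix of K(7,3), with eigenvalues 4, 2, −1, −3. As A + 3I − J/5 ⪰ 0,
-- (Σ x)² ≤ 5 xᵀ(A + 3I)x for every x. Take x = Σ tᵢ cᵢ, with cᵢ the indicator of the i-th component,
-- jᵢ its size and βᵢ = cᵢᵀ(A + 3I)cᵢ. Distinct components are not joined by edges, so the right hand
-- side is 5 Σ tᵢ² βᵢ. For tᵢ = 3 + 4/jᵢ, slightly increased if jᵢ ≥ 2, we have tᵢ βᵢ ≤ 21 jᵢ, so Σ tᵢ jᵢ ≤ 105, that is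
-- 4m + 3w ≤ 105 = 3 (w + |S|) for m components with w vertices in total, and equality forces w = m.
-- The condition tᵢ βᵢ ≤ 21 jᵢ is a lower bound on the edge boundary of a component. It follows
-- from the spectral gap 2I − A + 2J/35 ⪰ 0 for 4 ≤ j ≤ 30 and from counting for j ≤ 3; and j ≤ 30
-- because a vertex of another component and its neighbours are missed. The tᵢ are scaled by 10000.

private
  variable
    A Index : Set

-- Finite sums of natural numbers over lists.

∑ : List A → (A → ℕ) → ℕ
∑ xs f = sum (map f xs)

∑-cong : ∀ (xs : List A) {f g : A → ℕ} → (∀ {x} → x ∈ xs → f x ≡ g x) → ∑ xs f ≡ ∑ xs g
∑-cong []       f≡g = refl
∑-cong (x ∷ xs) f≡g = cong₂ _+_ (f≡g (here refl)) (∑-cong xs (f≡g ∘ there))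

∑-mono : ∀ (xs : List A) {f g : A → ℕ} → (∀ {x} → x ∈ xs → f x ≤ g x) → ∑ xs f ≤ ∑ xs g
∑-mono []       f≤g = z≤n
∑-mono (x ∷ xs) f≤g = +-mono-≤ (f≤g (here refl)) (∑-mono xs (f≤g ∘ there))

∑-mono-< : ∀ (xs : List A) {f g : A → ℕ} {k} → (∀ {x} → x ∈ xs → f x ≤ g x) →
           k ∈ xs → f k < g k → ∑ xs f < ∑ xs g
∑-mono-< (x ∷ xs) f≤g (here refl) fk<gk = +-mono-<-≤ fk<gk (∑-mono xs (f≤g ∘ there))
∑-mono-< (x ∷ xs) f≤g (there k∈)  fk<gk =
  +-mono-≤-< (f≤g (here refl)) (∑-mono-< xs (f≤g ∘ there) k∈ fk<gk)

∑-+ : ∀ (xs : List A) (f g : A → ℕ) → ∑ xs (λ x → f x + g x) ≡ ∑ xs f + ∑ xs g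
∑-+ []       f g = refl
∑-+ (x ∷ xs) f g rewrite ∑-+ xs f g = interchange (f x) (g x) (∑ xs f) (∑ xs g)
  where
  interchange : ∀ a b c d → a + b + (c + d) ≡ a + c + (b + d)
  interchange = solve-∀

∑-* : ∀ (xs : List A) c (f : A → ℕ) → ∑ xs (λ x → c * f x) ≡ c * ∑ xs f
∑-* []       c f = sym (*-zeroʳ c)
∑-* (x ∷ xs) c f = trans (cong (c * f x +_) (∑-* xs c f)) (sym (*-distribˡ-+ c (f x) (∑ xs f)))

∑-zero : ∀ (xs : List A) {f : A → ℕ} → (∀ {x} → x ∈ xs → f x ≡ 0) → ∑ xs f ≡ 0
∑-zero []       f≡0 = refl
∑-zero (x ∷ xs) f≡0 = cong₂ _+_ (f≡0 (here refl)) (∑-zero xs (f≡0 ∘ there))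

∑-swap : ∀ (xs : List A) (ys : List Index) (f : A → Index → ℕ) →
         ∑ xs (λ x → ∑ ys (f x)) ≡ ∑ ys (λ y → ∑ xs (λ x → f x y))
∑-swap []       ys f = sym (∑-zero ys (λ _ → refl))
∑-swap (x ∷ xs) ys f = trans (cong (∑ ys (f x) +_) (∑-swap xs ys f)) (sym (∑-+ ys _ _))

∑-single : ∀ {xs : List A} {k} {f : A → ℕ} → Unique xs → k ∈ xs →
           (∀ {x} → x ≢ k → f x ≡ 0) → ∑ xs f ≡ f k
∑-single {xs = x ∷ xs} {f = f} (x∉xs ∷ _) (here refl) f≡0 =
  trans (cong (f x +_) (∑-zero xs (λ y∈ → f≡0 (All.lookup x∉xs y∈ ∘ sym)))) (+-identityʳ (f x))
∑-single {xs = x ∷ xs} (x∉xs ∷ uniq) (there k∈) f≡0 =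
  cong₂ _+_ (f≡0 (All.lookup x∉xs k∈)) (∑-single uniq k∈ f≡0)

∑-term : ∀ {xs : List A} {k} (f : A → ℕ) → k ∈ xs → f k ≤ ∑ xs f
∑-term f (here refl) = m≤m+n _ _
∑-term f (there k∈)  = m≤n⇒m≤o+n _ (∑-term f k∈)

∑-two-terms : ∀ {xs : List A} {j k} (f : A → ℕ) → j ∈ xs → k ∈ xs → j ≢ k → f j + f k ≤ ∑ xs f
∑-two-terms f (here refl) (here refl) j≢k = contradiction refl j≢k
∑-two-terms f (here refl) (there k∈)  j≢k = +-monoʳ-≤ _ (∑-term f k∈)
∑-two-terms {j = j} {k} f (there j∈) (here refl) j≢k =
  ≤-trans (≤-reflexive (+-comm (f j) (f k))) (+-monoʳ-≤ _ (∑-term f j∈))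
∑-two-terms f (there j∈)  (there k∈)  j≢k = m≤n⇒m≤o+n _ (∑-two-terms f j∈ k∈ j≢k)

∑-allFin-1 : ∀ m → ∑ (allFin m) (λ _ → 1) ≡ m
∑-allFin-1 m = trans (go (allFin m)) (length-tabulate id)
  where
  go : ∀ (xs : List A) → ∑ xs (λ _ → 1) ≡ length xs
  go []       = refl
  go (_ ∷ xs) = cong suc (go xs)

-- Quadratic forms with natural-number kernels.

form : List A → (A → A → ℕ) → (A → ℕ) → ℕ
form xs κ x = ∑ xs λ u → ∑ xs λ v → κ u v * (x u * x v)

form-mono : ∀ (xs : List A) {κ κ′ : A → A → ℕ} x →
            (∀ {u v} → u ∈ xs → v ∈ xs → κ u v ≤ κ′ u v) → form xs κ x ≤ form xs κ′ x
form-mono xs x κ≤κ′ = ∑-mono xs λ u∈ → ∑-mono xs λ v∈ → *-monoˡ-≤ _ (κ≤κ′ u∈ v∈)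

form-+ : ∀ (xs : List A) (κ κ′ : A → A → ℕ) x →
         form xs (λ u v → κ u v + κ′ u v) x ≡ form xs κ x + form xs κ′ x
form-+ xs κ κ′ x = begin
  form xs (λ u v → κ u v + κ′ u v) x
    ≡⟨ ∑-cong xs (λ {u} _ → trans
         (∑-cong xs (λ {v} _ → *-distribʳ-+ (x u * x v) (κ u v) (κ′ u v))) (∑-+ xs _ _)) ⟩
  ∑ xs (λ u → ∑ xs (λ v → κ u v * (x u * x v)) + ∑ xs (λ v → κ′ u v * (x u * x v)))
    ≡⟨ ∑-+ xs _ _ ⟩
  form xs κ x + form xs κ′ x ∎
  where open ≡-Reasoning

form-* : ∀ (xs : List A) c (κ : A → A → ℕ) x → form xs (λ u v → c * κ u v) x ≡ c * form xs κ x
form-* xs c κ x = trans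
  (∑-cong xs (λ {u} _ → trans
    (∑-cong xs (λ {v} _ → *-assoc c (κ u v) (x u * x v))) (∑-* xs c _)))
  (∑-* xs c _)

form-scale : ∀ (xs : List A) (κ : A → A → ℕ) c x →
             form xs κ (λ u → c * x u) ≡ c * (c * form xs κ x)
form-scale xs κ c x = trans
  (∑-cong xs λ {u} _ → trans
    (∑-cong xs λ {v} _ → factor (κ u v) c (x u) (x v))
    (trans (∑-* xs c _) (cong (c *_) (∑-* xs c _))))
  (trans (∑-* xs c _) (cong (c *_) (∑-* xs c _)))
  where
  factor : ∀ k c a b → k * (c * a * (c * b)) ≡ c * (c * (k * (a * b)))
  factor = solve-∀

form-∑ : ∀ (xs : List A) (rs : List Index) (κ : Index → A → A → ℕ) x →
         form xs (λ u v → ∑ rs (λ r → κ r u v)) x ≡ ∑ rs (λ r → form xs (κ r) x)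
form-∑ xs rs κ x = begin
  form xs (λ u v → ∑ rs (λ r → κ r u v)) x
    ≡⟨ ∑-cong xs (λ {u} _ → trans (∑-cong xs (λ {v} _ → ∑-*ʳ (x u * x v) (λ r → κ r u v))) (∑-swap xs rs _)) ⟩
  ∑ xs (λ u → ∑ rs (λ r → ∑ xs (λ v → κ r u v * (x u * x v))))
    ≡⟨ ∑-swap xs rs _ ⟩
  ∑ rs (λ r → form xs (κ r) x) ∎
  where
  open ≡-Reasoning
  ∑-*ʳ : ∀ c (f : _ → ℕ) → ∑ rs f * c ≡ ∑ rs (λ r → f r * c)
  ∑-*ʳ c f = trans (*-comm (∑ rs f) c)
    (trans (sym (∑-* rs c f)) (∑-cong rs (λ {r} _ → *-comm c (f r))))

form-⊗ : ∀ (xs : List A) (f g x : A → ℕ) →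
         form xs (λ u v → f u * g v) x ≡ ∑ xs (λ u → f u * x u) * ∑ xs (λ v → g v * x v)
form-⊗ xs f g x = begin
  form xs (λ u v → f u * g v) x
    ≡⟨ ∑-cong xs (λ {u} _ → trans
         (∑-cong xs (λ {v} _ → rearrange (f u) (g v) (x u) (x v))) (∑-* xs (f u * x u) _)) ⟩
  ∑ xs (λ u → f u * x u * G)
    ≡⟨ ∑-cong xs (λ {u} _ → *-comm (f u * x u) G) ⟩
  ∑ xs (λ u → G * (f u * x u))
    ≡⟨ ∑-* xs G _ ⟩
  G * ∑ xs (λ u → f u * x u)
    ≡⟨ *-comm G _ ⟩
  ∑ xs (λ u → f u * x u) * G ∎
  where
  open ≡-Reasoning
  G = ∑ xs (λ v → g v * x v)
  rearrange : ∀ a b c d → a * b * (c * d) ≡ a * c * (b * d)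
  rearrange = solve-∀

form-⊗+⊗ : ∀ (xs : List A) (f g h k x : A → ℕ) →
           form xs (λ u v → f u * g v + h u * k v) x ≡
           ∑ xs (λ u → f u * x u) * ∑ xs (λ v → g v * x v) +
           ∑ xs (λ u → h u * x u) * ∑ xs (λ v → k v * x v)
form-⊗+⊗ xs f g h k x = trans
  (form-+ xs (λ u v → f u * g v) (λ u v → h u * k v) x)
  (cong₂ _+_ (form-⊗ xs f g x) (form-⊗ xs h k x))

form-1 : ∀ (xs : List A) x → form xs (λ _ _ → 1) x ≡ ∑ xs x * ∑ xs x
form-1 xs x = trans (form-⊗ xs (λ _ → 1) (λ _ → 1) x) (cong₂ _*_ 1*x 1*x)
  where
  1*x = ∑-cong xs (λ {u} _ → *-identityˡ (x u))

-- Sums of squares without subtraction.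

-- A square w · (Σ (p u − n u) x u)², with parts u = (p u , n u): differences are kept as
-- pairs of naturals, and a sum of squares is nonnegative in the form crossed ≤ straight.
record Square (A : Set) : Set where
  constructor square
  field
    weight : ℕ
    parts  : A → ℕ × ℕ
open Square

straight crossed : ℕ × ℕ → ℕ × ℕ → ℕ
straight (p , n) (p′ , n′) = p * p′ + n * n′
crossed  (p , n) (p′ , n′) = p * n′ + n * p′

gram : (ℕ × ℕ → ℕ × ℕ → ℕ) → List (Square A) → A → A → ℕ
gram _∙_ rs u v = ∑ rs λ r → weight r * (parts r u ∙ parts r v)

-- Lowering both arguments by one leaves (m - n)² unchanged, so the induction descends until one of
-- them is zero.
2mn≤m²+n² : ∀ m n → m * n + n * m ≤ m * m + n * n
2mn≤m²+n² zero    n       = ≤-trans (≤-reflexive (*-zeroʳ n)) z≤n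
2mn≤m²+n² (suc m) zero    = ≤-trans (≤-reflexive (trans (+-identityʳ _) (*-zeroʳ m))) z≤n
2mn≤m²+n² (suc m) (suc n) = begin
  suc m * suc n + suc n * suc m          ≡⟨ expand₁ m n ⟩
  m * n + n * m + (2 * m + 2 * n + 2)    ≤⟨ +-monoˡ-≤ _ (2mn≤m²+n² m n) ⟩
  m * m + n * n + (2 * m + 2 * n + 2)    ≡⟨ expand₂ m n ⟩
  suc m * suc m + suc n * suc n          ∎
  where
  open ≤-Reasoning
  expand₁ : ∀ m n → suc m * suc n + suc n * suc m ≡ m * n + n * m + (2 * m + 2 * n + 2)
  expand₁ = solve-∀
  expand₂ : ∀ m n → m * m + n * n + (2 * m + 2 * n + 2) ≡ suc m * suc m + suc n * suc n
  expand₂ = solve-∀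

form-crossed≤straight : ∀ (xs : List A) rs x → form xs (gram crossed rs) x ≤ form xs (gram straight rs) x
form-crossed≤straight xs rs x = begin
  form xs (gram crossed rs) x
    ≡⟨ form-∑ xs rs _ x ⟩
  ∑ rs (λ r → form xs (λ u v → weight r * crossed (parts r u) (parts r v)) x)
    ≤⟨ ∑-mono rs (λ {r} _ → term r) ⟩
  ∑ rs (λ r → form xs (λ u v → weight r * straight (parts r u) (parts r v)) x)
    ≡⟨ form-∑ xs rs _ x ⟨
  form xs (gram straight rs) x ∎
  where
  open ≤-Reasoning
  term : ∀ r → form xs (λ u v → weight r * crossed (parts r u) (parts r v)) x
             ≤ form xs (λ u v → weight r * straight (parts r u) (parts r v)) x
  term r = begin
    form xs (λ u v → weight r * crossed (parts r u) (parts r v)) x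
      ≡⟨ form-* xs (weight r) _ x ⟩
    weight r * form xs (λ u v → pos u * neg v + neg u * pos v) x
      ≡⟨ cong (weight r *_) (form-⊗+⊗ xs pos neg neg pos x) ⟩
    weight r * (P * N + N * P)
      ≤⟨ *-monoʳ-≤ (weight r) (2mn≤m²+n² P N) ⟩
    weight r * (P * P + N * N)
      ≡⟨ cong (weight r *_) (form-⊗+⊗ xs pos pos neg neg x) ⟨
    weight r * form xs (λ u v → pos u * pos v + neg u * neg v) x
      ≡⟨ form-* xs (weight r) _ x ⟨
    form xs (λ u v → weight r * straight (parts r u) (parts r v)) x ∎
    where
    pos neg : _ → ℕ
    pos = proj₁ ∘ parts r
    neg = proj₂ ∘ parts r
    P = ∑ xs (λ u → pos u * x u)
    N = ∑ xs (λ u → neg u * x u)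

-- The absence of edges between components enters here: after expansion, every cross term with i ≢ k
-- vanishes.
form-separated : ∀ (xs : List A) (κ : A → A → ℕ) {is : List Index} (y : Index → A → ℕ) → Unique is →
  (∀ {i k u v} → i ≢ k → u ∈ xs → v ∈ xs → κ u v * (y i u * y k v) ≡ 0) →
  form xs κ (λ u → ∑ is (λ i → y i u)) ≡ ∑ is (λ i → form xs κ (y i))
form-separated xs κ {is} y unique sep = begin
  form xs κ (λ u → ∑ is (λ i → y i u))
    ≡⟨ ∑-cong xs (λ u∈ → ∑-cong xs (λ v∈ → diagonal u∈ v∈)) ⟩
  ∑ xs (λ u → ∑ xs (λ v → ∑ is (λ i → κ u v * (y i u * y i v))))
    ≡⟨ ∑-cong xs (λ {u} _ → ∑-swap xs is (λ v i → κ u v * (y i u * y i v))) ⟩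
  ∑ xs (λ u → ∑ is (λ i → ∑ xs (λ v → κ u v * (y i u * y i v))))
    ≡⟨ ∑-swap xs is (λ u i → ∑ xs (λ v → κ u v * (y i u * y i v))) ⟩
  ∑ is (λ i → form xs κ (y i)) ∎
  where
  open ≡-Reasoning
  diagonal : ∀ {u v} → u ∈ xs → v ∈ xs →
             κ u v * (∑ is (λ i → y i u) * ∑ is (λ k → y k v)) ≡ ∑ is (λ i → κ u v * (y i u * y i v))
  diagonal {u} {v} u∈ v∈ = begin
    κ u v * (∑ is (λ i → y i u) * Z)     ≡⟨ pull (κ u v) _ Z ⟩
    κ u v * Z * ∑ is (λ i → y i u)       ≡⟨ ∑-* is (κ u v * Z) (λ i → y i u) ⟨
    ∑ is (λ i → κ u v * Z * y i u)       ≡⟨ ∑-cong is (λ {i} i∈ → row i∈) ⟩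
    ∑ is (λ i → κ u v * (y i u * y i v)) ∎
    where
    Z = ∑ is (λ k → y k v)
    pull : ∀ a b c → a * (b * c) ≡ a * c * b
    pull = solve-∀
    push : ∀ a b c → a * b * c ≡ a * c * b
    push = solve-∀
    row : ∀ {i} → i ∈ is → κ u v * Z * y i u ≡ κ u v * (y i u * y i v)
    row {i} i∈ = begin
      κ u v * Z * y i u                        ≡⟨ push (κ u v) Z (y i u) ⟩
      κ u v * y i u * Z                        ≡⟨ ∑-* is (κ u v * y i u) (λ k → y k v) ⟨
      ∑ is (λ k → κ u v * y i u * y k v)       ≡⟨ ∑-cong is (λ {k} _ → *-assoc (κ u v) (y i u) (y k v)) ⟩
      ∑ is (λ k → κ u v * (y i u * y k v))     ≡⟨ ∑-single unique i∈ (λ k≢i → sep (k≢i ∘ sym) u∈ v∈) ⟩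
      κ u v * (y i u * y i v)                  ∎

-- Subsets of fixed size and their intersections.

subsets : ∀ n → ℕ → List (Subset n)
subsets zero    zero    = [] ∷ []
subsets zero    (suc k) = []
subsets (suc n) zero    = map (false ∷_) (subsets n zero)
subsets (suc n) (suc k) = map (true ∷_) (subsets n k) ++ map (false ∷_) (subsets n (suc k))

∈-subsets⁺ : ∀ {n} k (u : Subset n) → ∣ u ∣ ≡ k → u ∈ subsets n k
∈-subsets⁺ zero    []          eq = here refl
∈-subsets⁺ zero    (false ∷ u) eq = ∈-map⁺ (false ∷_) (∈-subsets⁺ zero u eq)
∈-subsets⁺ (suc k) (true ∷ u)  eq = ∈-++⁺ˡ (∈-map⁺ (true ∷_) (∈-subsets⁺ k u (suc-injective eq)))
∈-subsets⁺ {suc n} (suc k) (false ∷ u) eq =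
  ∈-++⁺ʳ (map (true ∷_) (subsets n k)) (∈-map⁺ (false ∷_) (∈-subsets⁺ (suc k) u eq))

∈-subsets⁻ : ∀ {n} k {u : Subset n} → u ∈ subsets n k → ∣ u ∣ ≡ k
∈-subsets⁻ {zero}  zero    (here refl) = refl
∈-subsets⁻ {suc n} zero    u∈ with ∈-map⁻ (false ∷_) u∈
... | _ , v∈ , refl = ∈-subsets⁻ zero v∈
∈-subsets⁻ {suc n} (suc k) u∈ with ∈-++⁻ (map (true ∷_) (subsets n k)) u∈
... | inj₁ u∈ˡ with ∈-map⁻ (true ∷_) u∈ˡ
...   | _ , v∈ , refl = cong suc (∈-subsets⁻ k v∈)
∈-subsets⁻ {suc n} (suc k) u∈ | inj₂ u∈ʳ with ∈-map⁻ (false ∷_) u∈ʳ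
...   | _ , v∈ , refl = ∈-subsets⁻ (suc k) v∈

meet : ∀ {n} → Subset n → Subset n → ℕ
meet []          []          = 0
meet (true ∷ u)  (true ∷ v)  = suc (meet u v)
meet (true ∷ u)  (false ∷ v) = meet u v
meet (false ∷ u) (_ ∷ v)     = meet u v

meet≡0⇒Adjacent : ∀ {n} (u v : Subset n) → meet u v ≡ 0 → Adjacent u v
meet≡0⇒Adjacent (true ∷ u)  (false ∷ v) eq (_ , there x∈) = meet≡0⇒Adjacent u v eq (_ , x∈)
meet≡0⇒Adjacent (false ∷ u) (_ ∷ v)     eq (_ , there x∈) = meet≡0⇒Adjacent u v eq (_ , x∈)

-- A kernel invariant under permutations of [7] depends only on the size of the intersection, which
-- is at most 3 here; four values describe it.
by-meet : ∀ {X : Set} → X → X → X → X → ℕ → X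
by-meet x₀ x₁ x₂ x₃ 0 = x₀
by-meet x₀ x₁ x₂ x₃ 1 = x₁
by-meet x₀ x₁ x₂ x₃ 2 = x₂
by-meet x₀ x₁ x₂ x₃ _ = x₃

-- Vertices and matrices of K(7,3).

opaque
  points V : List (Subset 7)
  -- A point of [7] is represented by its singleton, so that `meet a u` is the indicator of
  -- membership.
  points = subsets 7 1
  V      = subsets 7 3

-- On V, δ is the identity matrix I, B = A + 3I with A the adjacency matrix of K(7,3), and N = A + I.
B δ N : Subset 7 → Subset 7 → ℕ
B u v = by-meet 1 0 0 3 (meet u v)
δ u v = by-meet 0 0 0 1 (meet u v)
N u v = by-meet 1 0 0 1 (meet u v)

-- The Gram matrices of P₁ 1, P₂ 1, P₃ 1 are 490 E₁, 75 E₂, 900 E₃, where Eᵢ are the orthogonal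
-- projections onto the eigenspaces of A for the eigenvalues −3, 2, −1 (and E₀ = J / 35 for 4).
P₁ P₂ P₃ : ℕ → List (Square (Subset 7))
P₁ c = map (λ w → square c λ u → by-meet (0 , 3) (4 , 0) (0 , 0) (0 , 0) (meet w u)) (subsets 7 1)
P₂ c = map (λ w → square c λ u → by-meet (1 , 0) (0 , 1) (2 , 0) (0 , 0) (meet w u)) (subsets 7 2)
P₃ c = map (λ w → square c λ u → by-meet (0 , 3) (2 , 0) (0 , 3) (12 , 0) (meet w u)) (subsets 7 3)

-- Entrywise checks over the 35 vertices.

opaque
  unfolding points V

  on-V : {P : Subset 7 → Set} (P? : U.Decidable P) {_ : True (all? P? V)} →
         ∀ {u} → u ∈ V → P u
  on-V P? {t} = All.lookup (toWitness t)

  on-V² : {R : Subset 7 → Subset 7 → Set} (R? : R.Decidable R)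
          {_ : True (all? (λ u → all? (R? u) V) V)} →
          ∀ {u v} → u ∈ V → v ∈ V → R u v
  on-V² R? {t} u∈ v∈ = All.lookup (All.lookup (toWitness t) u∈) v∈

  -- 450 (A + 3I) − 90 J = 30 · 75 E₂ + 900 E₃
  ratio-kernel : ∀ {u v} → u ∈ V → v ∈ V →
    gram straight (P₂ 30 ++ P₃ 1) u v + 90 * 1 ≤ gram crossed (P₂ 30 ++ P₃ 1) u v + 450 * B u v
  ratio-kernel = on-V² λ u v →
    gram straight (P₂ 30 ++ P₃ 1) u v + 90 * 1 ≤? gram crossed (P₂ 30 ++ P₃ 1) u v + 450 * B u v

  -- 14700 (2I − A) + 840 J = 150 · 490 E₁ + 49 · 900 E₃, with 2I − A = 5I − B
  gap-kernel : ∀ {u v} → u ∈ V → v ∈ V →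
    gram straight (P₁ 150 ++ P₃ 49) u v + 14700 * B u v
    ≤ gram crossed (P₁ 150 ++ P₃ 49) u v + (840 * 1 + 73500 * δ u v)
  gap-kernel = on-V² λ u v →
    gram straight (P₁ 150 ++ P₃ 49) u v + 14700 * B u v
    ≤? gram crossed (P₁ 150 ++ P₃ 49) u v + (840 * 1 + 73500 * δ u v)

  -- For intersections of size 0, 1, 2, 3 the left side is 2, 1, 2, 9 and the right side 2, 2, 2, 9.
  degree-kernel : ∀ {u v} → u ∈ V → v ∈ V →
    2 * B u v + ∑ points (λ a → meet a u * meet a v) ≤ 2 * 1 + 7 * δ u v
  degree-kernel = on-V² λ u v → 2 * B u v + ∑ points (λ a → meet a u * meet a v) ≤? 2 * 1 + 7 * δ u v

  meet-points : ∀ {u} → u ∈ V → ∑ points (λ a → meet a u) ≡ 3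
  meet-points = on-V λ u → ∑ points (λ a → meet a u) ≟ 3

  δ-row : ∀ {u} → u ∈ V → ∑ V (δ u) ≡ 1
  δ-row = on-V λ u → ∑ V (δ u) ≟ 1

  N-row : ∀ {u} → u ∈ V → ∑ V (N u) ≡ 5
  N-row = on-V λ u → ∑ V (N u) ≟ 5

  meet≥3⇒≡ : ∀ {u v} → u ∈ V → v ∈ V → 3 ≤ meet u v → u ≡ v
  meet≥3⇒≡ = on-V² λ u v → (3 ≤? meet u v) →-dec ≡-dec Bool._≟_ u v

  -- `subsets` lists the triples in the same order as `allSubsets`, whose other members contribute
  -- zero, so both sides compute to the same sum.
  size≡∑ : ∀ S → size 7 3 S ≡ ∑ V (λ u → if S u then 1 else 0)
  size≡∑ S = refl

  ∈-V⁺ : ∀ u → ∣ u ∣ ≡ 3 → u ∈ V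
  ∈-V⁺ = ∈-subsets⁺ 3

  ∈-V⁻ : ∀ {u} → u ∈ V → ∣ u ∣ ≡ 3
  ∈-V⁻ = ∈-subsets⁻ 3

  ∑-V-1 : ∑ V (λ _ → 1) ≡ 35
  ∑-V-1 = refl

  ∑-points-2 : ∑ points (λ _ → 2) ≡ 14
  ∑-points-2 = refl

-- The Hoffman inequality.

-- By `ratio-kernel`, 450 B - 90 J dominates a sum of squares entrywise, and x has no negative
-- entries. The crossed terms `C` occur on both sides and cancel; then 90 is divided out.
hoffman : ∀ x → ∑ V x * ∑ V x ≤ 5 * form V B x
hoffman x = *-cancelˡ-≤ 90 (+-cancelˡ-≤ (form V (gram crossed rs) x) _ _ (begin
  C + 90 * (∑ V x * ∑ V x)
    ≤⟨ +-monoˡ-≤ _ (form-crossed≤straight V rs x) ⟩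
  form V (gram straight rs) x + 90 * (∑ V x * ∑ V x)
    ≡⟨ cong (λ t → form V (gram straight rs) x + 90 * t) (form-1 V x) ⟨
  form V (gram straight rs) x + 90 * form V (λ _ _ → 1) x
    ≡⟨ cong (form V (gram straight rs) x +_) (form-* V 90 (λ _ _ → 1) x) ⟨
  form V (gram straight rs) x + form V (λ _ _ → 90 * 1) x
    ≡⟨ form-+ V (gram straight rs) (λ _ _ → 90 * 1) x ⟨
  form V (λ u v → gram straight rs u v + 90 * 1) x
    ≤⟨ form-mono V x ratio-kernel ⟩
  form V (λ u v → gram crossed rs u v + 450 * B u v) x
    ≡⟨ form-+ V (gram crossed rs) (λ u v → 450 * B u v) x ⟩
  C + form V (λ u v → 450 * B u v) x
    ≡⟨ cong (C +_) (form-* V 450 B x) ⟩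
  C + 450 * form V B x
    ≡⟨ cong (C +_) (*-assoc 90 5 (form V B x)) ⟩
  C + 90 * (5 * form V B x) ∎))
  where
  open ≤-Reasoning
  rs = P₂ 30 ++ P₃ 1
  C = form V (gram crossed rs) x

n*n≤k*n⇒n≤k : ∀ n k → n * n ≤ k * n → n ≤ k
n*n≤k*n⇒n≤k zero      k _ = z≤n
n*n≤k*n⇒n≤k n@(suc _) k p = *-cancelʳ-≤ n k n p

-- Edge bounds for a set of j vertices with indicator c.

module _ (c : Subset 7 → ℕ) (c≤1 : ∀ u → c u ≤ 1) where
  private
    j = ∑ V c
    β = form V B c

  form-δ : form V δ c ≤ j
  form-δ = ∑-mono V λ {u} u∈ → begin
    ∑ V (λ v → δ u v * (c u * c v))  ≤⟨ ∑-mono V (λ {v} _ → *-monoʳ-≤ (δ u v) (*-monoʳ-≤ (c u) (c≤1 v))) ⟩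
    ∑ V (λ v → δ u v * (c u * 1))    ≡⟨ ∑-cong V (λ {v} _ → *-comm (δ u v) (c u * 1)) ⟩
    ∑ V (λ v → c u * 1 * δ u v)      ≡⟨ ∑-* V (c u * 1) (δ u) ⟩
    c u * 1 * ∑ V (δ u)              ≡⟨ cong₂ _*_ (*-identityʳ (c u)) (δ-row u∈) ⟩
    c u * 1                          ≡⟨ *-identityʳ (c u) ⟩
    c u                              ∎
    where open ≤-Reasoning

  -- This is 35 times β ≤ 5 j + 2 j² / 35, which is 2I - A + 2J/35 ⪰ 0 evaluated at c, with cᵀc ≤ j
  -- because c takes values at most 1.
  spectral-gap : β * 35 ≤ 2 * (j * j) + 175 * j
  spectral-gap = *-cancelˡ-≤ 420 (+-cancelˡ-≤ C _ _ (begin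
    C + 420 * (β * 35)
      ≤⟨ +-monoˡ-≤ _ (form-crossed≤straight V rs c) ⟩
    form V (gram straight rs) c + 420 * (β * 35)
      ≡⟨ cong (form V (gram straight rs) c +_) (regroup β) ⟩
    form V (gram straight rs) c + 14700 * β
      ≡⟨ cong (form V (gram straight rs) c +_) (form-* V 14700 B c) ⟨
    form V (gram straight rs) c + form V (λ u v → 14700 * B u v) c
      ≡⟨ form-+ V (gram straight rs) (λ u v → 14700 * B u v) c ⟨
    form V (λ u v → gram straight rs u v + 14700 * B u v) c
      ≤⟨ form-mono V c gap-kernel ⟩
    form V (λ u v → gram crossed rs u v + (840 * 1 + 73500 * δ u v)) c
      ≡⟨ form-+ V (gram crossed rs) (λ u v → 840 * 1 + 73500 * δ u v) c ⟩
    C + form V (λ u v → 840 * 1 + 73500 * δ u v) c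
      ≡⟨ cong (C +_) (trans (form-+ V (λ _ _ → 840 * 1) (λ u v → 73500 * δ u v) c)
           (cong₂ _+_ (trans (form-* V 840 (λ _ _ → 1) c) (cong (840 *_) (form-1 V c)))
                      (form-* V 73500 δ c))) ⟩
    C + (840 * (j * j) + 73500 * form V δ c)
      ≤⟨ +-monoʳ-≤ C (+-monoʳ-≤ (840 * (j * j)) (*-monoʳ-≤ 73500 form-δ)) ⟩
    C + (840 * (j * j) + 73500 * j)
      ≡⟨ cong (C +_) (distribute (j * j) j) ⟩
    C + 420 * (2 * (j * j) + 175 * j) ∎))
    where
    open ≤-Reasoning
    rs = P₁ 150 ++ P₃ 49
    C = form V (gram crossed rs) c
    regroup : ∀ b → 420 * (b * 35) ≡ 14700 * b
    regroup = solve-∀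
    distribute : ∀ a b → 840 * a + 73500 * b ≡ 420 * (2 * a + 175 * b)
    distribute = solve-∀

  -- For an indicator c, the number of triples of the family through the point a.
  degree : Subset 7 → ℕ
  degree a = ∑ V (λ u → meet a u * c u)

  ∑-degree : ∑ points degree ≡ 3 * j
  ∑-degree = begin
    ∑ points degree                             ≡⟨ ∑-swap points V (λ a u → meet a u * c u) ⟩
    ∑ V (λ u → ∑ points (λ a → meet a u * c u)) ≡⟨ ∑-cong V (λ {u} u∈ → row u∈) ⟩
    ∑ V (λ u → 3 * c u)                         ≡⟨ ∑-* V 3 c ⟩
    3 * j                                       ∎
    where
    open ≡-Reasoning
    row : ∀ {u} → u ∈ V → ∑ points (λ a → meet a u * c u) ≡ 3 * c u
    row {u} u∈ = begin
      ∑ points (λ a → meet a u * c u)  ≡⟨ ∑-cong points (λ {a} _ → *-comm (meet a u) (c u)) ⟩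
      ∑ points (λ a → c u * meet a u)  ≡⟨ ∑-* points (c u) (λ a → meet a u) ⟩
      c u * ∑ points (λ a → meet a u)  ≡⟨ cong (c u *_) (meet-points u∈) ⟩
      c u * 3                          ≡⟨ *-comm (c u) 3 ⟩
      3 * c u                          ∎

  -- The sum of squared degrees counts pairs (u, v) of the family with weight the size of their
  -- intersection. It is thus itself a quadratic form in c, and `degree-kernel` applies entrywise.
  degree-bound : 2 * β + ∑ points (λ a → degree a * degree a) ≤ 2 * (j * j) + 7 * j
  degree-bound = begin
    2 * β + ∑ points (λ a → degree a * degree a)
      ≡⟨ cong₂ _+_ (form-* V 2 B c)
           (trans (form-∑ V points κ c) (∑-cong points (λ {a} _ → form-⊗ V (meet a) (meet a) c))) ⟨
    form V (λ u v → 2 * B u v) c + form V (λ u v → ∑ points (λ a → κ a u v)) c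
      ≡⟨ form-+ V (λ u v → 2 * B u v) (λ u v → ∑ points (λ a → κ a u v)) c ⟨
    form V (λ u v → 2 * B u v + ∑ points (λ a → κ a u v)) c
      ≤⟨ form-mono V c degree-kernel ⟩
    form V (λ u v → 2 * 1 + 7 * δ u v) c
      ≡⟨ form-+ V (λ _ _ → 2 * 1) (λ u v → 7 * δ u v) c ⟩
    form V (λ _ _ → 2 * 1) c + form V (λ u v → 7 * δ u v) c
      ≡⟨ cong₂ _+_ (trans (form-* V 2 (λ _ _ → 1) c) (cong (2 *_) (form-1 V c))) (form-* V 7 δ c) ⟩
    2 * (j * j) + 7 * form V δ c
      ≤⟨ +-monoʳ-≤ (2 * (j * j)) (*-monoʳ-≤ 7 form-δ) ⟩
    2 * (j * j) + 7 * j ∎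
    where
    open ≤-Reasoning
    κ : Subset 7 → Subset 7 → Subset 7 → ℕ
    κ a u v = meet a u * meet a v

  -- Degrees are natural numbers, so d ≤ d² and (d − 1)(d − 2) ≥ 0; the second bound
  -- excludes triangles when j = 3, where the spectral gap is too weak.
  form-B≤₁ : 2 * β + 3 * j ≤ 2 * (j * j) + 7 * j
  form-B≤₁ = begin
    2 * β + 3 * j                                ≡⟨ cong (2 * β +_) ∑-degree ⟨
    2 * β + ∑ points degree                      ≤⟨ +-monoʳ-≤ (2 * β) (∑-mono points (λ {a} _ → n≤n² (degree a))) ⟩
    2 * β + ∑ points (λ a → degree a * degree a) ≤⟨ degree-bound ⟩
    2 * (j * j) + 7 * j                          ∎
    where
    open ≤-Reasoning
    n≤n² : ∀ n → n ≤ n * n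
    n≤n² zero    = z≤n
    n≤n² (suc n) = m≤m*n (suc n) (suc n)

  form-B≤₂ : 2 * β + 9 * j ≤ 2 * (j * j) + 7 * j + 14
  form-B≤₂ = begin
    2 * β + 9 * j
      ≡⟨ cong (2 * β +_) (trans (*-assoc 3 3 j) (trans (cong (3 *_) (sym ∑-degree)) (sym (∑-* points 3 degree)))) ⟩
    2 * β + ∑ points (λ a → 3 * degree a)
      ≤⟨ +-monoʳ-≤ (2 * β) (∑-mono points (λ {a} _ → 3n≤n²+2 (degree a))) ⟩
    2 * β + ∑ points (λ a → degree a * degree a + 2)
      ≡⟨ cong (2 * β +_) (trans (∑-+ points (λ a → degree a * degree a) (λ _ → 2))
                               (cong (∑ points (λ a → degree a * degree a) +_) ∑-points-2)) ⟩
    2 * β + (∑ points (λ a → degree a * degree a) + 14)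
      ≡⟨ +-assoc (2 * β) _ 14 ⟨
    2 * β + ∑ points (λ a → degree a * degree a) + 14
      ≤⟨ +-monoˡ-≤ 14 degree-bound ⟩
    2 * (j * j) + 7 * j + 14 ∎
    where
    open ≤-Reasoning
    3n≤n²+2 : ∀ n → 3 * n ≤ n * n + 2
    3n≤n²+2 0 = z≤n
    3n≤n²+2 1 = ≤-refl
    3n≤n²+2 2 = ≤-refl
    3n≤n²+2 n@(suc (suc (suc _))) = m≤n⇒m≤n+o 2 (*-monoˡ-≤ n {3} {n} (s≤s (s≤s (s≤s z≤n))))

-- Numerical bounds and the choice of weights.

-- For an indicator, β is 3 j plus twice the number of edges. The values 3, 8, 13 are 3 j + 2 (j -
-- 1), the value for a tree; from j = 4 on, the spectral gap rounded down.
B-bound : ℕ → ℕ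
B-bound 1 = 3
B-bound 2 = 8
B-bound 3 = 13
B-bound j = (2 * (j * j) + 175 * j) / 35

≤-B-bound : ∀ j β → β * 35 ≤ 2 * (j * j) + 175 * j →
               2 * β + 3 * j ≤ 2 * (j * j) + 7 * j → 2 * β + 9 * j ≤ 2 * (j * j) + 7 * j + 14 →
               β ≤ B-bound j
≤-B-bound 1 β _ p _ = *-cancelˡ-≤ 2 (+-cancelʳ-≤ 3 (2 * β) 6 p)
≤-B-bound 2 β _ p _ = *-cancelˡ-≤ 2 (+-cancelʳ-≤ 6 (2 * β) 16 p)
≤-B-bound 3 β _ _ p = *-cancelˡ-≤ 2 (+-cancelʳ-≤ 27 (2 * β) 26 p)
≤-B-bound 0 β p _ _ = subst (_≤ 0) (m*n/n≡m β 35) (/-monoˡ-≤ 35 p)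
≤-B-bound j@(suc (suc (suc (suc _)))) β p _ _ = subst (_≤ B-bound j) (m*n/n≡m β 35) (/-monoˡ-≤ 35 p)

-- 30001 + ⌈39999 / j⌉
scale : ℕ → ℕ
scale zero      = 0
scale j@(suc _) = 30002 + 39998 / j

-- Only just true: for j = 30 the second inequality reads 6298335 ≤ 6300000.
scale-bounds : ∀ {k} → k < 30 →
  30001 * suc k + 39999 ≤ scale (suc k) * suc k × scale (suc k) * B-bound (suc k) ≤ 210000 * suc k
scale-bounds = toWitness {a? = allUpTo? (λ k →
  (30001 * suc k + 39999 ≤? scale (suc k) * suc k) ×-dec
  (scale (suc k) * B-bound (suc k) ≤? 210000 * suc k)) 30} _

-- The left side 30001 j + 39999 is 30000 j + 40000 + (j - 1). The surplus j - 1 vanishes exactly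
-- for single vertices, and it is what settles the equality case.
scale-spec : ∀ j β → 1 ≤ j → j ≤ 30 → β ≤ B-bound j →
             30001 * j + 39999 ≤ scale j * j × scale j * β ≤ 210000 * j
scale-spec (suc k) β _ k<30 β≤ =
  proj₁ (scale-bounds k<30) , ≤-trans (*-monoʳ-≤ (scale (suc k)) β≤) (proj₂ (scale-bounds k<30))

-- Weighted count for mutually separated vertex sets.

module Separated {m} (c : Fin m → Subset 7 → ℕ) (2≤m : 2 ≤ m) (c≤1 : ∀ i u → c i u ≤ 1)
  (separated : ∀ {i k u v} → i ≢ k → u ∈ V → v ∈ V → B u v * (c i u * c k v) ≡ 0)
  (inhabited : ∀ i → Σ (Subset 7) λ u → u ∈ V × c i u ≡ 1) where

  private
    is = allFin m
    j β t : Fin m → ℕ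
    j i = ∑ V (c i)
    β i = form V B (c i)
    t i = scale (j i)

  1≤j : ∀ i → 1 ≤ j i
  1≤j i with inhabited i
  ... | u , u∈ , ciu≡1 = subst (_≤ j i) ciu≡1 (∑-term (c i) u∈)

  other : ∀ {n} → 2 ≤ n → (i : Fin n) → Σ (Fin n) (_≢ i)
  other (s≤s (s≤s _)) Fin.zero    = Fin.suc Fin.zero , λ ()
  other (s≤s (s≤s _)) (Fin.suc _) = Fin.zero , λ ()

  j≤30 : ∀ i → j i ≤ 30
  j≤30 i with other 2≤m i
  ... | k , k≢i with inhabited k
  ...   | u , u∈ , cku≡1 = +-cancelʳ-≤ 5 (j i) 30 (begin
    j i + 5                     ≡⟨ cong (j i +_) (N-row u∈) ⟨
    j i + ∑ V (N u)             ≡⟨ ∑-+ V (c i) (N u) ⟨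
    ∑ V (λ v → c i v + N u v)   ≤⟨ ∑-mono V (λ {v} v∈ → avoids v (zero-product v∈)) ⟩
    ∑ V (λ _ → 1)               ≡⟨ ∑-V-1 ⟩
    35                          ∎)
    where
    open ≤-Reasoning
    zero-product : ∀ {v} → v ∈ V → B u v * c i v ≡ 0
    zero-product {v} v∈ = begin-equality
      B u v * c i v           ≡⟨ cong (B u v *_) (+-identityʳ (c i v)) ⟨
      B u v * (1 * c i v)     ≡⟨ cong (λ z → B u v * (z * c i v)) cku≡1 ⟨
      B u v * (c k u * c i v) ≡⟨ separated k≢i u∈ v∈ ⟩
      0                       ∎
    avoids : ∀ v → B u v * c i v ≡ 0 → c i v + N u v ≤ 1
    avoids v p with meet u v
    -- At intersection 0, and at 3 below, `B u v` is 1 or 3, so `p` is a vanishing sum with first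
    -- summand `c i v`.
    ... | 0 = ≤-reflexive (cong (_+ 1) (m+n≡0⇒m≡0 (c i v) p))
    ... | 1 = ≤-trans (≤-reflexive (+-identityʳ (c i v))) (c≤1 i v)
    ... | 2 = ≤-trans (≤-reflexive (+-identityʳ (c i v))) (c≤1 i v)
    ... | suc (suc (suc _)) = ≤-reflexive (cong (_+ 1) (m+n≡0⇒m≡0 (c i v) p))

  t-bounds : ∀ i → 30001 * j i + 39999 ≤ t i * j i × t i * β i ≤ 210000 * j i
  t-bounds i = scale-spec (j i) (β i) (1≤j i) (j≤30 i)
    (≤-B-bound (j i) (β i) (spectral-gap (c i) (c≤1 i))
      (form-B≤₁ (c i) (c≤1 i)) (form-B≤₂ (c i) (c≤1 i)))

  x : Subset 7 → ℕ
  x u = ∑ is (λ i → t i * c i u)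

  Y : ℕ
  Y = ∑ is (λ i → t i * j i)

  ∑x≡Y : ∑ V x ≡ Y
  ∑x≡Y = trans (∑-swap V is (λ u i → t i * c i u)) (∑-cong is (λ {i} _ → ∑-* V (t i) (c i)))

  -- One factor t of t² β is absorbed by t β ≤ 210000 j. The bound becomes linear in `Y`, so that Y²
  -- ≤ 5 xᵀBx can be divided by `Y`.
  form-x≤ : form V B x ≤ 210000 * Y
  form-x≤ = begin
    form V B x                                 ≡⟨ form-separated V B (λ i u → t i * c i u) (allFin⁺ m) sep ⟩
    ∑ is (λ i → form V B (λ u → t i * c i u))  ≡⟨ ∑-cong is (λ {i} _ → form-scale V B (t i) (c i)) ⟩
    ∑ is (λ i → t i * (t i * β i))             ≤⟨ ∑-mono is (λ {i} _ → *-monoʳ-≤ (t i) (proj₂ (t-bounds i))) ⟩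
    ∑ is (λ i → t i * (210000 * j i))          ≡⟨ ∑-cong is (λ {i} _ → move (t i) 210000 (j i)) ⟩
    ∑ is (λ i → 210000 * (t i * j i))          ≡⟨ ∑-* is 210000 (λ i → t i * j i) ⟩
    210000 * Y                                 ∎
    where
    open ≤-Reasoning
    move : ∀ a b c → a * (b * c) ≡ b * (a * c)
    move = solve-∀
    gather : ∀ b s a t′ d → b * (s * a * (t′ * d)) ≡ s * t′ * (b * (a * d))
    gather = solve-∀
    sep : ∀ {i k u v} → i ≢ k → u ∈ V → v ∈ V → B u v * (t i * c i u * (t k * c k v)) ≡ 0
    sep {i} {k} {u} {v} i≢k u∈ v∈ = trans (gather (B u v) (t i) (c i u) (t k) (c k v))
      (trans (cong (t i * t k *_) (separated i≢k u∈ v∈)) (*-zeroʳ (t i * t k)))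

  Y≤1050000 : Y ≤ 1050000
  Y≤1050000 = n*n≤k*n⇒n≤k Y (5 * 210000) (begin
    Y * Y              ≡⟨ cong₂ _*_ ∑x≡Y ∑x≡Y ⟨
    ∑ V x * ∑ V x      ≤⟨ hoffman x ⟩
    5 * form V B x     ≤⟨ *-monoʳ-≤ 5 form-x≤ ⟩
    5 * (210000 * Y)   ≡⟨ *-assoc 5 210000 Y ⟨
    5 * 210000 * Y     ∎)
    where open ≤-Reasoning

  weighted-count : 30001 * ∑ is j + 39999 * m ≤ 1050000
  weighted-count = begin
    30001 * ∑ is j + 39999 * m
      ≡⟨ cong₂ _+_ (∑-* is 30001 j) (trans (∑-* is 39999 (λ _ → 1)) (cong (39999 *_) (∑-allFin-1 m))) ⟨
    ∑ is (λ i → 30001 * j i) + ∑ is (λ _ → 39999 * 1)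
      ≡⟨ ∑-+ is (λ i → 30001 * j i) (λ _ → 39999) ⟨
    ∑ is (λ i → 30001 * j i + 39999)
      ≤⟨ ∑-mono is (λ {i} _ → proj₁ (t-bounds i)) ⟩
    Y
      ≤⟨ Y≤1050000 ⟩
    1050000 ∎
    where open ≤-Reasoning

-- Indicators and the ratio bound for independent sets.

[_]ᵇ : Bool → ℕ
[ b ]ᵇ = if b then 1 else 0

[b]≤1 : ∀ b → [ b ]ᵇ ≤ 1
[b]≤1 true  = ≤-refl
[b]≤1 false = z≤n

[not]+[] : ∀ b → [ not b ]ᵇ + [ b ]ᵇ ≡ 1
[not]+[] true  = refl
[not]+[] false = refl

∑-not+size : ∀ S → ∑ V (λ u → [ not (S u) ]ᵇ) + size 7 3 S ≡ 35
∑-not+size S = begin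
  ∑ V (λ u → [ not (S u) ]ᵇ) + size 7 3 S              ≡⟨ cong (∑ V (λ u → [ not (S u) ]ᵇ) +_) (size≡∑ S) ⟩
  ∑ V (λ u → [ not (S u) ]ᵇ) + ∑ V (λ u → [ S u ]ᵇ)    ≡⟨ ∑-+ V _ _ ⟨
  ∑ V (λ u → [ not (S u) ]ᵇ + [ S u ]ᵇ)                ≡⟨ ∑-cong V (λ {u} _ → [not]+[] (S u)) ⟩
  ∑ V (λ _ → 1)                                        ≡⟨ ∑-V-1 ⟩
  35                                                   ∎
  where open ≡-Reasoning

-- On an independent set only the diagonal 3I of B survives, so the Hoffman inequality reads X² ≤ 15
-- X.
independent⇒size≤15 : ∀ J → Independent 7 3 J → size 7 3 J ≤ 15
independent⇒size≤15 J ind = subst (_≤ 15) (sym (size≡∑ J)) (n*n≤k*n⇒n≤k X 15 (begin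
  X * X                      ≤⟨ hoffman x ⟩
  5 * form V B x             ≤⟨ *-monoʳ-≤ 5 (∑-mono V λ u∈ → ∑-mono V λ v∈ → nonadjacent u∈ v∈) ⟩
  5 * form V (λ u v → 3 * δ u v) x ≡⟨ cong (5 *_) (form-* V 3 δ x) ⟩
  5 * (3 * form V δ x)       ≤⟨ *-monoʳ-≤ 5 (*-monoʳ-≤ 3 (form-δ x (λ u → [b]≤1 (J u)))) ⟩
  5 * (3 * X)                ≡⟨ *-assoc 5 3 X ⟨
  15 * X                     ∎))
  where
  open ≤-Reasoning
  x : Subset 7 → ℕ
  x u = [ J u ]ᵇ
  X = ∑ V x
  nonadjacent : ∀ {u v} → u ∈ V → v ∈ V → B u v * (x u * x v) ≤ 3 * δ u v * (x u * x v)
  nonadjacent {u} {v} u∈ v∈ with meet u v in eq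
  ... | 1 = ≤-refl
  ... | 2 = ≤-refl
  ... | suc (suc (suc _)) = ≤-refl
  ... | 0 with J u in Ju | J v in Jv
  ...   | false | _     = z≤n
  ...   | true  | false = z≤n
  ...   | true  | true  = contradiction (meet≡0⇒Adjacent u v eq) (ind u v (∈-V⁻ u∈) (∈-V⁻ v∈) Ju Jv)

-- The components left by a vertex cut.

module Cut (S : VSet 7) {m} (cut : VertexCut 7 3 S m) where

  private
    f : Subset 7 → Fin m
    f = proj₁ (proj₁ cut)

    c : Fin m → Subset 7 → ℕ
    c i u = [ not (S u) ∧ does (f u Fin.≟ i) ]ᵇ

    w = ∑ (allFin m) (λ i → ∑ V (c i))

  adjacent⇒f≡ : ∀ {u v} → Alive 7 3 S u → Alive 7 3 S v → Adjacent u v → f u ≡ f v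
  adjacent⇒f≡ {u} {v} au av adj = Equivalence.from (proj₂ (proj₂ (proj₁ cut)) u v au av) (step adj av here)

  c-own : ∀ {u} → S u ≡ false → c (f u) u ≡ 1
  c-own {u} Su rewrite Su | dec-true (f u Fin.≟ f u) refl = refl

  c-support : ∀ i u → c i u ≡ 0 ⊎ (S u ≡ false × f u ≡ i)
  c-support i u with S u | f u Fin.≟ i
  ... | true  | _        = inj₁ refl
  ... | false | no _     = inj₁ refl
  ... | false | yes fu≡i = inj₂ (refl , fu≡i)

  separated : ∀ {i k u v} → i ≢ k → u ∈ V → v ∈ V → B u v * (c i u * c k v) ≡ 0
  separated {i} {k} {u} {v} i≢k u∈ v∈ with c-support i u | c-support k v
  ... | inj₁ ciu≡0 | _ rewrite ciu≡0 = *-zeroʳ (B u v)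
  ... | _ | inj₁ ckv≡0 rewrite ckv≡0 | *-zeroʳ (c i u) = *-zeroʳ (B u v)
  ... | inj₂ (Su , refl) | inj₂ (Sv , refl) = cong (_* (c i u * c k v)) B≡0
    where
    B≡0 : B u v ≡ 0
    B≡0 with meet u v in eq
    ... | 0 = contradiction (adjacent⇒f≡ (∈-V⁻ u∈ , Su) (∈-V⁻ v∈ , Sv) (meet≡0⇒Adjacent u v eq)) i≢k
    ... | 1 = refl
    ... | 2 = refl
    -- The diagonal entry 3 of B is excluded as well: here u = v, and a vertex has a single label.
    ... | suc (suc (suc _)) = contradiction
      (cong f (meet≥3⇒≡ u∈ v∈ (subst (3 ≤_) (sym eq) (s≤s (s≤s (s≤s z≤n)))))) i≢k

  inhabited : ∀ i → Σ (Subset 7) λ u → u ∈ V × c i u ≡ 1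
  inhabited i with proj₁ (proj₂ (proj₁ cut)) i
  ... | u , (∣u∣≡3 , Su) , refl = u , ∈-V⁺ u ∣u∣≡3 , c-own Su

  open Separated c (proj₂ cut) (λ i u → [b]≤1 (not (S u) ∧ does (f u Fin.≟ i))) separated inhabited

  w≡ : w ≡ ∑ V (λ u → [ not (S u) ]ᵇ)
  w≡ = trans (∑-swap (allFin m) V c) (∑-cong V λ {u} _ → total u)
    where
    total : ∀ u → ∑ (allFin m) (λ i → c i u) ≡ [ not (S u) ]ᵇ
    total u with S u in Su
    ... | true  = ∑-zero (allFin m) (λ _ → refl)
    ... | false = trans (∑-single (allFin⁺ m) (∈-allFin (f u)) vanish)
                        (cong [_]ᵇ (dec-true (f u Fin.≟ f u) refl))
      where
      vanish : ∀ {i} → i ≢ f u → [ does (f u Fin.≟ i) ]ᵇ ≡ 0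
      vanish {i} i≢fu with f u Fin.≟ i
      ... | yes fu≡i = contradiction (sym fu≡i) i≢fu
      ... | no _     = refl

  w+size≡35 : w + size 7 3 S ≡ 35
  w+size≡35 = trans (cong (_+ size 7 3 S) w≡) (∑-not+size S)

  m≤w : m ≤ w
  m≤w = subst (_≤ w) (∑-allFin-1 m) (∑-mono (allFin m) (λ {i} _ → 1≤j i))

  -- The constant 1050000 is 30000 · 35, and 35 splits into surviving and deleted vertices.
  count : 30001 * w + 39999 * m ≤ 30000 * w + 30000 * size 7 3 S
  count = ≤-trans weighted-count (≤-reflexive
    (trans (cong (30000 *_) (sym w+size≡35)) (*-distribˡ-+ 30000 w (size 7 3 S))))

  private
    split : ∀ w m → 30000 * w + 10000 * (4 * m) ≡ 30000 * w + 39999 * m + m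
    split = solve-∀
    merge : ∀ w m → 30000 * w + 39999 * m + w ≡ 30001 * w + 39999 * m
    merge = solve-∀

  -- Cancelling 30000 w in `count` leaves w + 39999 m ≤ 30000 ∣S∣, and m ≤ w turns the left side
  -- into at least 40000 m.
  4m≤3size : 4 * m ≤ 3 * size 7 3 S
  4m≤3size = *-cancelˡ-≤ 10000 (+-cancelˡ-≤ (30000 * w) _ _ (begin
    30000 * w + 10000 * (4 * m)                  ≡⟨ split w m ⟩
    30000 * w + 39999 * m + m                    ≤⟨ +-monoʳ-≤ (30000 * w + 39999 * m) m≤w ⟩
    30000 * w + 39999 * m + w                    ≡⟨ merge w m ⟩
    30001 * w + 39999 * m                        ≤⟨ count ⟩
    30000 * w + 30000 * size 7 3 S               ≡⟨ cong (30000 * w +_) (*-assoc 10000 3 (size 7 3 S)) ⟩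
    30000 * w + 10000 * (3 * size 7 3 S)         ∎))
    where
    open ≤-Reasoning

  -- The equality case.

  module Extremal (extremal : 3 * size 7 3 S ≡ 4 * m) where

    -- Now 30000 ∣S∣ = 40000 m, so `count` reads w + 39999 m ≤ 40000 m. With the unperturbed weights
    -- 3 + 4/j the lone w would be missing.
    w≤m : w ≤ m
    w≤m = +-cancelˡ-≤ (30000 * w + 39999 * m) _ _ (begin
      30000 * w + 39999 * m + w                ≡⟨ merge w m ⟩
      30001 * w + 39999 * m                    ≤⟨ count ⟩
      30000 * w + 30000 * size 7 3 S           ≡⟨ cong (30000 * w +_) (*-assoc 10000 3 (size 7 3 S)) ⟩
      30000 * w + 10000 * (3 * size 7 3 S)     ≡⟨ cong (λ z → 30000 * w + 10000 * z) extremal ⟩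
      30000 * w + 10000 * (4 * m)              ≡⟨ split w m ⟩
      30000 * w + 39999 * m + m                ∎)
      where
      open ≤-Reasoning

    15≤w : 15 ≤ w
    15≤w = *-cancelˡ-≤ 7 (begin
      3 * 35                  ≡⟨ cong (3 *_) w+size≡35 ⟨
      3 * (w + size 7 3 S)    ≡⟨ *-distribˡ-+ 3 w (size 7 3 S) ⟩
      3 * w + 3 * size 7 3 S  ≡⟨ cong (3 * w +_) extremal ⟩
      3 * w + 4 * m           ≤⟨ +-monoʳ-≤ (3 * w) (*-monoʳ-≤ 4 m≤w) ⟩
      3 * w + 4 * w           ≡⟨ *-distribʳ-+ w 3 4 ⟨
      7 * w                   ∎)
      where open ≤-Reasoning

    I : VSet 7
    I = not ∘ S

    -- Two adjacent survivors share a component, which then has at least two vertices; the others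
    -- have at least one, so m < w.
    I-independent : Independent 7 3 I
    I-independent u v ∣u∣≡3 ∣v∣≡3 Iu Iv adj = <⇒≱ m<w w≤m
      where
      alive : ∀ {b} → not b ≡ true → b ≡ false
      alive = trans (sym (Bool.not-involutive _)) ∘ cong not
      u≢v : u ≢ v
      -- A set disjoint from itself is empty and cannot have size 3.
      u≢v refl = contradiction
        (trans (sym ∣u∣≡3) (trans (cong ∣_∣ (trans (sym (∩-idem u)) (Empty-unique adj))) (∣⊥∣≡0 7))) λ ()
      two≤j : 1 < ∑ V (c (f u))
      two≤j = subst (_≤ ∑ V (c (f u)))
        (cong₂ _+_ (c-own (alive Iu))
          (trans (cong (λ i → c i v) (adjacent⇒f≡ (∣u∣≡3 , alive Iu) (∣v∣≡3 , alive Iv) adj)) (c-own (alive Iv))))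
        (∑-two-terms (c (f u)) (∈-V⁺ u ∣u∣≡3) (∈-V⁺ v ∣v∣≡3) u≢v)
      m<w : m < w
      m<w = subst (_< w) (∑-allFin-1 m)
        (∑-mono-< (allFin m) (λ {i} _ → 1≤j i) (∈-allFin (f u)) two≤j)

    I-maximum : MaximumIndependent 7 3 I
    I-maximum = I-independent , λ J ind → begin
      size 7 3 J                  ≤⟨ independent⇒size≤15 J ind ⟩
      15                          ≤⟨ 15≤w ⟩
      w                           ≡⟨ w≡ ⟩
      ∑ V (λ u → [ I u ]ᵇ)        ≡⟨ size≡∑ I ⟨
      size 7 3 I                  ∎
      where open ≤-Reasoning

-- A cut attaining 4/3.

-- The 15 triples through the first point, an Erdős-Ko-Rado family. Deleting the other 20 leaves 15
-- isolated vertices, with ratio 20/15.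
star : List (Subset 7)
star = map (true ∷_) (subsets 6 2)

off-star : VSet 7
off-star (b ∷ _) = not b

∈-star : ∀ {u} → Alive 7 3 off-star u → u ∈ star
∈-star {true ∷ u} (∣u∣≡3 , _) = ∈-map⁺ (true ∷_) (∈-subsets⁺ 2 u (suc-injective ∣u∣≡3))

star-alive : ∀ {u} → u ∈ star → Alive 7 3 off-star u
star-alive u∈ with ∈-map⁻ (true ∷_) u∈
... | _ , v∈ , refl = cong suc (∈-subsets⁻ 2 v∈) , refl

star-index : Subset 7 → Fin 15
star-index u with u ∈? star
... | yes u∈ = index u∈
-- An arbitrary label: only surviving vertices matter, and they all lie in `star`.
... | no _   = Fin.zero

lookup-star-index : ∀ {u} → u ∈ star → u ≡ lookup star (star-index u)
lookup-star-index {u} u∈ with u ∈? star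
... | yes u∈′ = lookup-index u∈′
... | no u∉   = contradiction u∈ u∉

star-index-lookup : ∀ i → star-index (lookup star i) ≡ i
star-index-lookup = toWitness {a? = Fin.all? λ i → star-index (lookup star i) Fin.≟ i} _

-- A step would join two disjoint triples that both contain the first point.
star-reach : ∀ {u v} → Alive 7 3 off-star u → Reach 7 3 off-star u v → u ≡ v
star-reach au here = refl
star-reach {true ∷ _} au (step {v = true ∷ _} adj _ _) = contradiction (Fin.zero , here) adj

off-star-cut : VertexCut 7 3 off-star 15
off-star-cut =
  (star-index
  , (λ i → lookup star i , star-alive (∈-lookup i) , star-index-lookup i)
  , λ u v au av → mk⇔
      (λ eq → subst (Reach 7 3 off-star u)
        (trans (lookup-star-index (∈-star au))
          (trans (cong (lookup star) eq) (sym (lookup-star-index (∈-star av))))) here)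
      (λ r → cong star-index (star-reach au r)))
  , s≤s (s≤s z≤n)

theorem22 : ToughnessIs 7 3 4 3
    × ((S : VSet 7) (m : ℕ) → VertexCut 7 3 S m → 3 * size 7 3 S ≡ 4 * m →
    Σ (VSet 7) λ I → MaximumIndependent 7 3 I × IsComplementOf 7 3 S I)
theorem22 =
  ((λ S m cut → Cut.4m≤3size S cut) , off-star , 15 , off-star-cut , refl)
  , λ S m cut extremal → let open Cut.Extremal S cut extremal in
      I , I-maximum , λ v _ → sym (Bool.not-involutive (S v))
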